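{- Let $r>3$ and let $P_r$ be a maximal (strong, resp. weak) Gallai-Schur partition of $[1,m]$ into $r$ colours, with colours labelled in natural order. Then the colours of $1,2,3$ are either $1,2,2$ or $1,2,1$ respectively. In the first case, $m \equiv 4 \pmod 5$ and $P_r$ is the image under ${}^5\Theta$ of a (strong, resp. weak) Gallai-Schur partition of $[1,(m-4)/5]$ into $r-2$ colours. In the second case, $m$ is odd and $P_r$ is the image under ${}^2\Theta$ of a (strong, resp. weak) Gallai-Schur partition of $[1,(m-1)/2]$ into $r-1$ colours.
   Context: A partition of $[1,n]=\{1,\dots,n\}$ into $r$ non-empty disjoint subsets (colours) $S_1,\dots,S_r$ is a (strong) Gallai-Schur $r$-partition if (i) no subset contains integers $a,b,c$ (not necessarily distinct) with $a+b=c$, and (ii) there are no $a,b,c\in[1,n]$ with $a+b=c$ lying in three different subsets. It is a weak Gallai-Schur $r$-partition if (i) is replaced by: no subset contains three distinct integers $a,b,c$ with $a+b=c$; (ii) is kept. A (strong, resp. weak) Gallai-Schur partition of $[1,m]$ into $r$ colours is maximal if there is no (strong, resp. weak) Gallai-Schur partition of a larger interval $[1,m']$, $m'>m$, into $r$ colours. Colours are labelled in natural order: if $i<j$ then $\min S_i < \min S_j$. Given a partition $S_1,\dots,S_r$ of $[1,k]$: its image under ${}^2\Theta$ is the partition of $[1,2k+1]$ into $r+1$ subsets consisting of the set of all odd integers in $[1,2k+1]$ together with the sets $2S_t=\{2x : x\in S_t\}$, $1\le t\le r$; its image under ${}^5\Theta$ is the partition of $[1,5k+4]$ into $r+2$ subsets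 consisting of the set of integers in $[1,5k+4]$ congruent to $2$ or $3 \pmod 5$, the set of those congruent to $1$ or $4 \pmod 5$, and the sets $5S_t=\{5x: x\in S_t\}$, $1\le t\le r$ (images being considered up to relabelling of the colours). -}

module Defs where

open import Data.Nat using (ℕ; zero; suc; _+_; _*_; _∸_; _≤_; _<_; NonZero)
open import Data.Nat.DivMod using (_/_; _%_)
open import Data.Product using (Σ; ∃; _×_; _,_)
open import Data.Sum using (_⊎_)
open import Data.Empty using (⊥)
open import Relation.Nullary using (¬_)
open import Relation.Binary.PropositionalEquality using (_≡_; _≢_)
open import Function.Bundles using (_⇔_)

-- A colouring is a function ℕ → ℕ; only its values on [1,n] matter.
-- Colours are 0,1,…,r-1 (colour i+1 of the paper is label i here).
Colouring : Set
Colouring = ℕ → ℕ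

InRange : ℕ → ℕ → Set
InRange n x = 1 ≤ x × x ≤ n

IsPartition : ℕ → ℕ → Colouring → Set
IsPartition n r c =
  (∀ x → InRange n x → c x < r) ×
  (∀ i → i < r → ∃ λ x → InRange n x × c x ≡ i)

data Kind : Set where
  strong weak : Kind

-- condition (i): monochromatic sums forbidden (strong: a,b,a+b not necessarily
-- distinct; weak: a,b,a+b distinct, which for positive a,b means a ≢ b)
SumFree : Kind → ℕ → Colouring → Set
SumFree strong n c = ∀ a b → InRange n a → InRange n b → InRange n (a + b) →
  ¬ (c a ≡ c b × c b ≡ c (a + b))
SumFree weak n c = ∀ a b → InRange n a → InRange n b → InRange n (a + b) →
  a ≢ b → ¬ (c a ≡ c b × c b ≡ c (a + b))

RainbowFree : ℕ → Colouring → Set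
RainbowFree n c = ∀ a b → InRange n a → InRange n b → InRange n (a + b) →
  ¬ (c a ≢ c b × c b ≢ c (a + b) × c a ≢ c (a + b))

GallaiSchur : Kind → ℕ → ℕ → Colouring → Set
GallaiSchur k n r c = IsPartition n r c × SumFree k n c × RainbowFree n c

Maximal : Kind → ℕ → ℕ → Colouring → Set
Maximal k m r c = GallaiSchur k m r c ×
  (∀ m' → m < m' → (d : Colouring) → ¬ GallaiSchur k m' r d)

-- natural order: if i < j then min S_i < min S_j, i.e. every element of
-- S_j is preceded by some element of S_i
NaturalOrder : ℕ → ℕ → Colouring → Set
NaturalOrder n r c = ∀ i j → i < j → j < r → ∀ x → InRange n x → c x ≡ j →
  ∃ λ y → InRange n y × y < x × c y ≡ i

SamePartition : ℕ → Colouring → Colouring → Set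
SamePartition n c d = ∀ x y → InRange n x → InRange n y →
  (c x ≡ c y) ⇔ (d x ≡ d y)

Θ2 : ℕ → Colouring → Colouring
Θ2 r q x with x % 2
... | zero = q (x / 2)
... | suc _ = r

Θ5 : ℕ → Colouring → Colouring
Θ5 r q x with x % 5
... | 0 = q (x / 5)
... | 1 = suc r
... | 2 = r
... | 3 = r
... | _ = suc r

{-# OPTIONS --safe #-}
module Submission where

-- Let x be the least element of the third colour. Rainbow-freeness makes the
-- two-coloured word on [1,x-1] a palindrome, and weak sum-freeness then leaves
-- only the words ABA, ABBA, ABABA and ABBBA. After ABBBA the colours up to 9
-- are forced and 10 cannot be coloured, so a fourth colour rules it out. After
-- ABBA the colours of all non-multiples of 5 are forced, and after ABA and
-- ABABA the colours of all odd numbers are. So the partition is an initial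
-- segment of an image under Θ5 or Θ2; these maps preserve the Gallai-Schur
-- property, hence by maximality the segment is the whole image.

open import Defs
open import Data.Nat using (ℕ; zero; suc; _+_; _*_; _∸_; _≤_; _<_; z≤n; s≤s; NonZero; >-nonZero⁻¹)
open import Data.Nat.DivMod using (_/_; _%_; m≡m%n+[m/n]*n; m%n<n; m*n%n≡0; m*n/n≡m; m/n*n≤m; [m+kn]%n≡m%n; DivMod; result; _divMod_; _mod_)
open import Data.Nat.Induction using (<-rec)
open import Data.Nat.Properties
open import Data.Nat.Tactic.RingSolver using (solve-∀)
open import Data.Fin as Fin using (Fin; zero; suc; toℕ)
open import Data.Fin.Properties as Fin using (all?; toℕ≤pred[n])
open import Data.Fin.Patterns using (0F; 1F; 2F; 3F; 4F)
open import Data.Product using (∃; ∃₂; _×_; _,_; proj₁; proj₂)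
open import Data.Sum using (_⊎_; inj₁; inj₂; swap)
open import Data.Unit using (⊤; tt)
open import Data.Empty using (⊥; ⊥-elim)
open import Function using (_∘_)
open import Function.Bundles using (mk⇔)
open import Relation.Nullary using (¬_; Dec; yes; no; contradiction; ¬?; _×-dec_; _⊎-dec_)
open import Relation.Nullary.Decidable using (from-yes)
open import Relation.Binary.Definitions using (tri<; tri≈; tri>)
open import Relation.Unary using (Decidable)
open import Relation.Binary.PropositionalEquality using (_≡_; _≢_; refl; sym; trans; cong; subst; subst₂; module ≡-Reasoning)

-- Common treatment of strong and weak sum-freeness

Eligible : Kind → ℕ → ℕ → Set
Eligible strong a b = ⊤
Eligible weak   a b = a ≢ b

≢⇒eligible : ∀ k {a b} → a ≢ b → Eligible k a b
≢⇒eligible strong _   = tt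
≢⇒eligible weak   a≢b = a≢b

eligible-map : ∀ k {a b a′ b′} → (a′ ≡ b′ → a ≡ b) → Eligible k a b → Eligible k a′ b′
eligible-map strong _ _   = tt
eligible-map weak   f a≢b = a≢b ∘ f

sumFree-elim : ∀ k {n c} → SumFree k n c → ∀ a b → InRange n a → InRange n b →
  InRange n (a + b) → Eligible k a b → ¬ (c a ≡ c b × c b ≡ c (a + b))
sumFree-elim strong sf a b ra rb rs _ = sf a b ra rb rs
sumFree-elim weak   sf = sf

sumFree-intro : ∀ k {n c} → (∀ a b → InRange n a → InRange n b → InRange n (a + b) →
  Eligible k a b → ¬ (c a ≡ c b × c b ≡ c (a + b))) → SumFree k n c
sumFree-intro strong f a b ra rb rs = f a b ra rb rs tt
sumFree-intro weak   f = f

-- A triple with exactly two colours is neither monochromatic nor rainbow, so it is harmless for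
-- both kinds without any distinctness condition.
data TwoColoured (x y z : ℕ) : Set where
  xxy : x ≡ y → x ≢ z → TwoColoured x y z
  xyx : x ≡ z → x ≢ y → TwoColoured x y z
  yxx : y ≡ z → x ≢ y → TwoColoured x y z

twoColoured⇒¬mono : ∀ {x y z} → TwoColoured x y z → ¬ (x ≡ y × y ≡ z)
twoColoured⇒¬mono (xxy _ x≢z) (x≡y , y≡z) = x≢z (trans x≡y y≡z)
twoColoured⇒¬mono (xyx _ x≢y) (x≡y , _)   = x≢y x≡y
twoColoured⇒¬mono (yxx _ x≢y) (x≡y , _)   = x≢y x≡y

twoColoured⇒¬rainbow : ∀ {x y z} → TwoColoured x y z → ¬ (x ≢ y × y ≢ z × x ≢ z)
twoColoured⇒¬rainbow (xxy x≡y _) (x≢y , _ , _) = x≢y x≡y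
twoColoured⇒¬rainbow (xyx x≡z _) (_ , _ , x≢z) = x≢z x≡z
twoColoured⇒¬rainbow (yxx y≡z _) (_ , y≢z , _) = y≢z y≡z

minimal : ∀ {P : ℕ → Set} → Decidable P → ∀ n → P n → ∃ λ x → x ≤ n × P x × (∀ y → y < x → ¬ P y)
minimal {P} P? = <-rec _ step
  where
  step : ∀ n → (∀ {y} → y < n → P y → ∃ λ x → x ≤ y × P x × (∀ z → z < x → ¬ P z)) →
         P n → ∃ λ x → x ≤ n × P x × (∀ y → y < x → ¬ P y)
  step n rec Pn with anyUpTo? P? n
  ... | no none = n , ≤-refl , Pn , λ y y<n Py → none (y , y<n , Py)
  ... | yes (y , y<n , Py) with rec y<n Py
  ...   | x , x≤y , rest = x , ≤-trans x≤y (<⇒≤ y<n) , rest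

<2⇒0∨1 : ∀ {n} → n < 2 → n ≡ 0 ⊎ n ≡ 1
<2⇒0∨1 {0} _ = inj₁ refl
<2⇒0∨1 {1} _ = inj₂ refl
<2⇒0∨1 {suc (suc _)} (s≤s (s≤s ()))

≢0∧≢1⇒2≤ : ∀ {n} → n ≢ 0 → n ≢ 1 → 2 ≤ n
≢0∧≢1⇒2≤ {0} n≢0 _ = contradiction refl n≢0
≢0∧≢1⇒2≤ {1} _ n≢1 = contradiction refl n≢1
≢0∧≢1⇒2≤ {suc (suc _)} _ _ = s≤s (s≤s z≤n)

-- Two sums with the same value each leave two candidate colours for it, and only the shared
-- candidate survives. Most forced colours are obtained this way.
meet : ∀ {w x y z : ℕ} → w ≡ x ⊎ w ≡ y → w ≡ x ⊎ w ≡ z → y ≢ z → w ≡ x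
meet (inj₁ w≡x) _          _   = w≡x
meet (inj₂ _)   (inj₁ w≡x) _   = w≡x
meet (inj₂ w≡y) (inj₂ w≡z) y≢z = contradiction (trans (sym w≡y) w≡z) y≢z

-- Colours forced by the first few integers

module Forcing (k : Kind) (m r : ℕ) (c : Colouring) (gs : GallaiSchur k m r c) where

  in-range : ∀ x .{{_ : NonZero x}} → x ≤ m → InRange m x
  in-range x x≤m = >-nonZero⁻¹ x , x≤m

  -- Asking for distinct summands makes this valid for both kinds, so every forcing argument below
  -- covers the strong and the weak case at once.
  mono≢ : ∀ a b .{{_ : NonZero a}} .{{_ : NonZero b}} {x} → a ≢ b → a + b ≤ m →
          c a ≡ x → c b ≡ x → c (a + b) ≢ x
  mono≢ a b a≢b s≤m ca cb cs =
    sumFree-elim k (proj₁ (proj₂ gs)) a b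
      (in-range a (≤-trans (m≤m+n a b) s≤m)) (in-range b (≤-trans (m≤n+m b a) s≤m))
      (≤-trans (>-nonZero⁻¹ a) (m≤m+n a b) , s≤m)
      (≢⇒eligible k a≢b) (trans ca (sym cb) , trans cb (sym cs))

  third : ∀ a b .{{_ : NonZero a}} .{{_ : NonZero b}} {x y} → a + b ≤ m →
          c a ≡ x → c b ≡ y → x ≢ y → c (a + b) ≡ x ⊎ c (a + b) ≡ y
  third a b {x} {y} s≤m refl refl x≢y with c (a + b) ≟ x | c (a + b) ≟ y
  ... | yes p | _     = inj₁ p
  ... | no _  | yes q = inj₂ q
  ... | no ¬p | no ¬q = ⊥-elim (proj₂ (proj₂ gs) a b
    (in-range a (≤-trans (m≤m+n a b) s≤m)) (in-range b (≤-trans (m≤n+m b a) s≤m))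
    (≤-trans (>-nonZero⁻¹ a) (m≤m+n a b) , s≤m) (x≢y , ¬q ∘ sym , ¬p ∘ sym))

  -- The interval may end inside a row, so each entry carries its own bound; the induction can then
  -- run over all `u`.
  record Row5 (u : ℕ) : Set where
    field
      at1 : 1 + u * 5 ≤ m → c (1 + u * 5) ≡ 0
      at2 : 2 + u * 5 ≤ m → c (2 + u * 5) ≡ 1
      at3 : 3 + u * 5 ≤ m → c (3 + u * 5) ≡ 1
      at4 : 4 + u * 5 ≤ m → c (4 + u * 5) ≡ 0

  module Fives (c1 : c 1 ≡ 0) (c2 : c 2 ≡ 1) (c3 : c 3 ≡ 1) (c4 : c 4 ≡ 0) where

    open Row5

    -- Colour 0 would make `1 + (4 + u * 5)` monochromatic, and colour 1 would do the same to
    -- `2 + (3 + u * 5)`.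
    multiple≥2 : ∀ u → Row5 u → suc u * 5 ≤ m → 2 ≤ c (suc u * 5)
    multiple≥2 u row le = ≢0∧≢1⇒2≤
      (mono≢ 1 (4 + u * 5) (λ ()) le c1 (at4 row (≤-trans (n≤1+n _) le)))
      (mono≢ 2 (3 + u * 5) (λ ()) le c2 (at3 row (≤-trans (m≤n+m _ 2) le)))

    -- Each new entry is reached by two sums. One uses the preceding multiple of 5, of colour at
    -- least 2; the other has summands coloured 0 and 1. The only common candidate is the colour of
    -- the first sum's small summand.
    row-suc : ∀ u → Row5 u → Row5 (suc u)
    row-suc u row = record { at1 = f1 ; at2 = f2 ; at3 = f3 ; at4 = f4 }
      where
      drop : ∀ i {j} → i + j ≤ m → j ≤ m
      drop i = ≤-trans (m≤n+m _ i)

      X≢0 : suc u * 5 ≤ m → c (suc u * 5) ≢ 0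
      X≢0 le = m<n⇒n≢0 (multiple≥2 u row le)
      X≢1 : suc u * 5 ≤ m → c (suc u * 5) ≢ 1
      X≢1 le = <⇒≢ (multiple≥2 u row le) ∘ sym

      f1 : 6 + u * 5 ≤ m → c (6 + u * 5) ≡ 0
      f1 le = meet (third 1 (5 + u * 5) le c1 refl (X≢0 (drop 1 le) ∘ sym))
                   (third 4 (2 + u * 5) le c4 (at2 row (drop 4 le)) (λ ())) (X≢1 (drop 1 le))
      f2 : 7 + u * 5 ≤ m → c (7 + u * 5) ≡ 1
      f2 le = meet (third 2 (5 + u * 5) le c2 refl (X≢1 (drop 2 le) ∘ sym))
                   (swap (third 4 (3 + u * 5) le c4 (at3 row (drop 4 le)) (λ ()))) (X≢0 (drop 2 le))
      f3 : 8 + u * 5 ≤ m → c (8 + u * 5) ≡ 1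
      f3 le = meet (third 3 (5 + u * 5) le c3 refl (X≢1 (drop 3 le) ∘ sym))
                   (third 2 (6 + u * 5) le c2 (f1 (drop 2 le)) (λ ())) (X≢0 (drop 3 le))
      f4 : 9 + u * 5 ≤ m → c (9 + u * 5) ≡ 0
      f4 le = meet (third 4 (5 + u * 5) le c4 refl (X≢0 (drop 4 le) ∘ sym))
                   (third 1 (8 + u * 5) le c1 (f3 (drop 1 le)) (λ ())) (X≢1 (drop 4 le))

    row : ∀ u → Row5 u
    row zero    = record { at1 = λ _ → c1 ; at2 = λ _ → c2 ; at3 = λ _ → c3 ; at4 = λ _ → c4 }
    row (suc u) = row-suc u (row u)

  -- For odd `x` from 5 on, `2 + (x - 2)` allows colours 0 and 1 while `4 + (x - 4)` allows 0 and 2.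
  -- Reaching back by 4 requires the base cases 1 and 3.
  ABAC⇒odd≡0 : c 1 ≡ 0 → c 2 ≡ 1 → c 3 ≡ 0 → c 4 ≡ 2 →
               ∀ u → 1 + u * 2 ≤ m → c (1 + u * 2) ≡ 0
  ABAC⇒odd≡0 c1 c2 c3 c4 = odd
    where
    odd : ∀ u → 1 + u * 2 ≤ m → c (1 + u * 2) ≡ 0
    odd 0 _ = c1
    odd 1 _ = c3
    odd (suc (suc u)) le = meet
      (swap (third 2 (3 + u * 2) le c2 (odd (suc u) (≤-trans (m≤n+m _ 2) le)) (λ ())))
      (swap (third 4 (1 + u * 2) le c4 (odd u (≤-trans (m≤n+m _ 4) le)) (λ ()))) (λ ())

  -- As before, with 6 as the element of the third colour in place of 4; the step reaches back by 6,
  -- so 5 is a further base case.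
  ABABAC⇒odd≡0 : c 1 ≡ 0 → c 2 ≡ 1 → c 3 ≡ 0 → c 5 ≡ 0 → c 6 ≡ 2 →
                 ∀ u → 1 + u * 2 ≤ m → c (1 + u * 2) ≡ 0
  ABABAC⇒odd≡0 c1 c2 c3 c5 c6 = odd
    where
    odd : ∀ u → 1 + u * 2 ≤ m → c (1 + u * 2) ≡ 0
    odd 0 _ = c1
    odd 1 _ = c3
    odd 2 _ = c5
    odd (suc (suc (suc u))) le = meet
      (swap (third 2 (5 + u * 2) le c2 (odd (suc (suc u)) (≤-trans (m≤n+m _ 2) le)) (λ ())))
      (swap (third 6 (1 + u * 2) le c6 (odd u (≤-trans (m≤n+m _ 6) le)) (λ ()))) (λ ())

  even≥1 : c 1 ≡ 0 → c 2 ≡ 1 → (∀ u → 1 + u * 2 ≤ m → c (1 + u * 2) ≡ 0) →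
           ∀ u → suc u * 2 ≤ m → 1 ≤ c (suc u * 2)
  -- The number 2 is separate because `1 + 1` has equal summands, which the weak condition ignores.
  even≥1 c1 c2 odd zero    _  = subst (1 ≤_) (sym c2) ≤-refl
  even≥1 c1 c2 odd (suc u) le = n≢0⇒n>0
    (mono≢ 1 (3 + u * 2) (λ ()) le c1 (odd (suc u) (≤-trans (n≤1+n _) le)))

  -- The forced colours make 2 + 8 = 10 monochromatic.
  ABBBAC⇒no-fourth-colour : c 1 ≡ 0 → c 2 ≡ 1 → c 3 ≡ 1 → c 4 ≡ 1 → c 5 ≡ 0 → c 6 ≡ 2 →
                ∀ w → InRange m w → c w ≢ 3
  ABBBAC⇒no-fourth-colour c1 c2 c3 c4 c5 c6 w (1≤w , w≤m) cw =
    mono≢ 2 8 (λ ()) ≤10 c2 c8 c10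
    where
    -- An element `w` of the fourth colour lies past every position whose colour is already known.
    -- This yields the bound on `m` needed to force the next colour.
    beyond : ∀ {n x} → n ≤ w → c n ≡ x → x ≢ 3 → n < w
    beyond n≤w cn x≢3 = ≤∧≢⇒< n≤w λ where refl → x≢3 (trans (sym cn) cw)

    7≤w : 7 ≤ w
    7≤w = beyond (beyond (beyond (beyond (beyond (beyond 1≤w c1 (λ ())) c2 (λ ())) c3 (λ ())) c4 (λ ())) c5 (λ ())) c6 (λ ())
    ≤7 : 7 ≤ m
    ≤7 = ≤-trans 7≤w w≤m
    c7 : c 7 ≡ 0
    c7 = meet (third 1 6 ≤7 c1 c6 (λ ())) (swap (third 2 5 ≤7 c2 c5 (λ ()))) (λ ())
    8≤w : 8 ≤ w
    8≤w = beyond 7≤w c7 (λ ())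
    ≤8 : 8 ≤ m
    ≤8 = ≤-trans 8≤w w≤m
    c8 : c 8 ≡ 1
    c8 = meet (third 2 6 ≤8 c2 c6 (λ ())) (third 3 5 ≤8 c3 c5 (λ ())) (λ ())
    9≤w : 9 ≤ w
    9≤w = beyond 8≤w c8 (λ ())
    ≤9 : 9 ≤ m
    ≤9 = ≤-trans 9≤w w≤m
    c9 : c 9 ≡ 1
    c9 = meet (third 3 6 ≤9 c3 c6 (λ ())) (third 2 7 ≤9 c2 c7 (λ ())) (λ ())
    ≤10 : 10 ≤ m
    ≤10 = ≤-trans (beyond 9≤w c9 (λ ())) w≤m
    c10 : c 10 ≡ 1
    c10 = meet (third 4 6 ≤10 c4 c6 (λ ())) (swap (third 1 9 ≤10 c1 c9 (λ ()))) (λ ())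

  -- The names spell the colours of 1, 2, 3, ... with A, B, C for 0, 1, 2, ending at the first C.
  -- Only the entries used later are stored; those of 1 and 2 are common to all cases.
  data Start : Set where
    ABAC   : c 3 ≡ 0 → c 4 ≡ 2 → Start
    ABABAC : c 3 ≡ 0 → c 5 ≡ 0 → c 6 ≡ 2 → Start
    ABBAC  : c 3 ≡ 1 → c 4 ≡ 0 → Start
    ABBBAC : c 3 ≡ 1 → c 4 ≡ 1 → c 5 ≡ 0 → c 6 ≡ 2 → Start

  -- The word before the first element of the third colour

  module Initial (2<r : 2 < r) (nat : NaturalOrder m r c) where

    c1≡0 : 1 ≤ m → c 1 ≡ 0
    c1≡0 1≤m with c 1 in eq
    ... | zero  = refl
    ... | suc j with nat 0 (suc j) (s≤s z≤n) (subst (_< r) eq (proj₁ (proj₁ gs) 1 (≤-refl , 1≤m))) 1 (≤-refl , 1≤m) eq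
    ...   | y , (1≤y , _) , y<1 , _ = contradiction y<1 (≤⇒≯ 1≤y)

    module First (x : ℕ) (rx : InRange m x) (cx : c x ≡ 2) (below : ∀ y → InRange m y → y < x → c y < 2) where

      c1 : c 1 ≡ 0
      c1 = c1≡0 (≤-trans (proj₁ rx) (proj₂ rx))

      -- If `a` and `b` differed in colour, rainbow-freeness would give `x` one of their colours;
      -- but `x` has colour 2 and everything before it a smaller one.
      mirror : ∀ a b .{{_ : NonZero a}} .{{_ : NonZero b}} → a + b ≡ x → c a ≡ c b
      mirror a b refl with c a ≟ c b
      ... | yes eq = eq
      ... | no ca≢cb with third a b (proj₂ rx) refl refl ca≢cb
      ...   | inj₁ eq = contradiction (trans (sym eq) cx) (<⇒≢ (below a (in-range a (≤-trans (m≤m+n a b) (proj₂ rx))) (m<m+n a (>-nonZero⁻¹ b))))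
      ...   | inj₂ eq = contradiction (trans (sym eq) cx) (<⇒≢ (below b (in-range b (≤-trans (m≤n+m b a) (proj₂ rx))) (m<n+m b (>-nonZero⁻¹ a))))

      binary : ∀ y .{{_ : NonZero y}} → y < x → c y ≡ 0 ⊎ c y ≡ 1
      binary y y<x = <2⇒0∨1 (below y (in-range y (≤-trans (<⇒≤ y<x) (proj₂ rx))) y<x)

      4≤x : 4 ≤ x
      4≤x with nat 1 2 ≤-refl 2<r x rx cx
      ... | zero , (() , _) , _
      ... | 1 , _ , _ , cy = contradiction (trans (sym c1) cy) (λ ())
      -- If `x` were 3, reflection would give 1 and 2 the same colour.
      ... | 2 , _ , 2<x , cy = ≤∧≢⇒< 2<x λ 3≡x → contradiction (trans (sym c1) (trans (mirror 1 2 3≡x) cy)) (λ ())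
      ... | suc (suc (suc y)) , _ , y<x , _ = ≤-trans (m≤m+n 4 y) y<x

    module Bounds (z : ℕ) (rx : InRange m (4 + z)) (cx : c (4 + z) ≡ 2) (below : ∀ y → InRange m y → y < 4 + z → c y < 2) where
      open First (4 + z) rx cx below public

      c2 : c 2 ≡ 1
      c2 with binary 2 (m≤m+n 3 (suc z))
      ... | inj₂ eq = eq
      -- With `x = 4 + z`, reflection copies the colour 0 of 1 and 2 to `x - 1` and `x - 2`, making
      -- `1 + (x - 2) = x - 1` monochromatic.
      ... | inj₁ eq = ⊥-elim (go z refl)
        where
        go : ∀ y → y ≡ z → ⊥
        go zero refl = mono≢ 1 2 (λ ()) (≤-trans (n≤1+n 3) (proj₂ rx)) c1 eq (trans (sym (mirror 1 3 refl)) c1)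
        go (suc y) refl = mono≢ 1 (3 + y) (λ ()) (≤-trans (n≤1+n _) (proj₂ rx)) c1
          (trans (sym (mirror 2 (3 + y) refl)) eq) (trans (sym (mirror 1 (4 + y) refl)) c1)

      start : Start
      start = go z refl
        where
        go : ∀ y → y ≡ z → Start
        go 0 refl = ABAC (trans (sym (mirror 1 3 refl)) c1) cx
        go 1 refl = ABBAC (trans (sym (mirror 2 3 refl)) c2) (trans (sym (mirror 1 4 refl)) c1)
        go 2 refl with binary 3 (m≤m+n 4 2)
        ... | inj₁ c3 = ABABAC c3 (trans (sym (mirror 1 5 refl)) c1) cx
        ... | inj₂ c3 = ABBBAC c3 (trans (sym (mirror 2 4 refl)) c2) (trans (sym (mirror 1 5 refl)) c1) cx
        -- Here `x = 7 + y`. Since 2 and 4 have colour 1, so do their reflections `x - 2` and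
        -- `x - 4`, and `2 + (x - 4) = x - 2` is monochromatic.
        go (suc (suc (suc y))) refl = ⊥-elim
          (mono≢ 2 (3 + y) (λ ()) (≤-trans (m≤n+m _ 2) (proj₂ rx)) c2
            (trans (sym (mirror 4 (3 + y) refl)) c4) (trans (sym (mirror 2 (5 + y) refl)) c2))
          where
          ≤m : ∀ i → i + y ≤ 7 + y → i ≤ m
          ≤m i le = ≤-trans (m≤m+n i y) (≤-trans le (proj₂ rx))
          -- If 4 had colour 0, then `1 + 3` would force colour 1 on 3, and 5 could be neither 0, by
          -- `1 + 4`, nor 1, by `2 + 3`.
          c4 : c 4 ≡ 1
          c4 with binary 4 (m≤m+n 5 (2 + y)) | binary 3 (m≤m+n 4 (3 + y)) | binary 5 (m≤m+n 6 (1 + y))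
          ... | inj₂ eq | _ | _ = eq
          ... | inj₁ eq | inj₁ c3 | _ = contradiction eq (mono≢ 1 3 (λ ()) (≤m 4 (m≤n+m _ 3)) c1 c3)
          ... | inj₁ eq | inj₂ c3 | inj₁ c5 = contradiction c5 (mono≢ 1 4 (λ ()) (≤m 5 (m≤n+m _ 2)) c1 eq)
          ... | inj₁ eq | inj₂ c3 | inj₂ c5 = contradiction c5 (mono≢ 2 3 (λ ()) (≤m 5 (m≤n+m _ 2)) c2 c3)

    classification : c 1 ≡ 0 × c 2 ≡ 1 × Start
    classification with proj₂ (proj₁ gs) 2 2<r
    -- The search starts at 0, so it runs over predecessors to stay among positive integers.
    ... | w , rw , cw with minimal (λ y → c (suc y) ≟ 2) (w ∸ 1) (trans (cong c (m+[n∸m]≡n (proj₁ rw))) cw)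
    ... | x , x≤w , cx , least = found (suc x) rx cx below (First.4≤x (suc x) rx cx below)
      where
      rx : InRange m (suc x)
      rx = s≤s z≤n , ≤-trans (s≤s x≤w) (≤-trans (≤-reflexive (m+[n∸m]≡n (proj₁ rw))) (proj₂ rw))
      below : ∀ y → InRange m y → y < suc x → c y < 2
      below (suc y) ry (s≤s y<x) with <-cmp (c (suc y)) 2
      ... | tri< lt _ _ = lt
      ... | tri≈ _ eq _ = contradiction eq (least y y<x)
      -- A colour above 2 is preceded by an element of colour 2, against minimality.
      ... | tri> _ _ gt with nat 2 (c (suc y)) gt (proj₁ (proj₁ gs) (suc y) ry) (suc y) ry refl
      ...   | suc v , _ , s≤s v<y , cv = contradiction cv (least v (<-trans v<y y<x))
      found : ∀ x → InRange m x → c x ≡ 2 → (∀ y → InRange m y → y < x → c y < 2) → 4 ≤ x →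
              c 1 ≡ 0 × c 2 ≡ 1 × Start
      found _ rx cx below (s≤s (s≤s (s≤s (s≤s {n = z} z≤n)))) = c1 , c2 , start
        where open Bounds z rx cx below

-- Passing between a partition and its multiples of `p`

module _ (p : ℕ) .{{_ : NonZero p}} where

  m<[1+m/p]*p : ∀ m → m < suc (m / p) * p
  m<[1+m/p]*p m = begin-strict
    m                      ≡⟨ m≡m%n+[m/n]*n m p ⟩
    m % p + m / p * p      <⟨ +-monoˡ-< (m / p * p) (m%n<n m p) ⟩
    suc (m / p) * p        ∎
    where open ≤-Reasoning

  inRange-* : ∀ {n N u} → n * p ≤ N → InRange n u → InRange N (u * p)
  inRange-* np≤N (1≤u , u≤n) =
    *-mono-≤ 1≤u (>-nonZero⁻¹ p) , ≤-trans (*-monoˡ-≤ p u≤n) np≤N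

  inRange-*⁻¹ : ∀ {n N} u → N < suc n * p → InRange N (u * p) → InRange n u
  inRange-*⁻¹ zero    _ (() , _)
  inRange-*⁻¹ {n} (suc u) N<p[1+n] (_ , up≤N) =
    s≤s z≤n , ≤-pred (*-cancelʳ-< p (suc u) (suc n) (≤-<-trans up≤N N<p[1+n]))

  -- The hypotheses say that colours below `t` sit exactly on the non-multiples of `p`. Hence
  -- subtracting `t` is injective on the colours of multiples, and every remaining colour is
  -- attained at a multiple.
  restrict-gallaiSchur : ∀ t k {m r c} → GallaiSchur k m (t + r) c →
    (∀ u → InRange m (u * p) → t ≤ c (u * p)) →
    (∀ x → InRange m x → t ≤ c x → ∃ λ u → x ≡ u * p) →
    GallaiSchur k (m / p) r (λ u → c (u * p) ∸ t)
  restrict-gallaiSchur t k {m} {r} {c} ((bounded , onto) , sumFree , rainbowFree) mult≥ ≥mult =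
    ((λ u ru → subst (c (u * p) ∸ t <_) (m+n∸m≡n t r)
        (∸-monoˡ-< (bounded (u * p) (up ru)) (mult≥ u (up ru)))) , onto′) ,
    sumFree-intro k (λ a b ra rb rs el (ca≡cb , cb≡cs) →
      sumFree-elim k sumFree (a * p) (b * p) (up ra) (up rb) (sum-up a b rs)
        (eligible-map k (*-cancelʳ-≡ a b p) el)
        (reflect ra rb ca≡cb , trans (reflect rb rs cb≡cs) (cong c (*-distribʳ-+ p a b)))) ,
    λ a b ra rb rs (ca≢cb , cb≢cs , ca≢cs) →
      rainbowFree (a * p) (b * p) (up ra) (up rb) (sum-up a b rs)
        ( (λ eq → ca≢cb (cong (_∸ t) eq))
        , (λ eq → cb≢cs (cong (_∸ t) (trans eq (cong c (sym (*-distribʳ-+ p a b))))))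
        , (λ eq → ca≢cs (cong (_∸ t) (trans eq (cong c (sym (*-distribʳ-+ p a b)))))))
    where
    up : ∀ {u} → InRange (m / p) u → InRange m (u * p)
    up = inRange-* (m/n*n≤m m p)

    sum-up : ∀ a b → InRange (m / p) (a + b) → InRange m (a * p + b * p)
    sum-up a b rs = subst (InRange m) (*-distribʳ-+ p a b) (up rs)

    reflect : ∀ {u v} → InRange (m / p) u → InRange (m / p) v →
              c (u * p) ∸ t ≡ c (v * p) ∸ t → c (u * p) ≡ c (v * p)
    reflect {u} {v} ru rv = ∸-cancelʳ-≡ (mult≥ u (up ru)) (mult≥ v (up rv))

    onto′ : ∀ i → i < r → ∃ λ u → InRange (m / p) u × c (u * p) ∸ t ≡ i
    onto′ i i<r with onto (t + i) (+-monoʳ-< t i<r)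
    ... | x , rx , cx with ≥mult x rx (subst (t ≤_) (sym cx) (m≤m+n t i))
    ...   | u , refl = u , inRange-*⁻¹ u (m<[1+m/p]*p m) rx , trans (cong (_∸ t) cx) (m+n∸m≡n t i)

  -- A sum of two multiples of `p` is inherited from `q`, and `split` makes every other sum exactly
  -- two-coloured. The bound on `N` keeps the quotients within `[1,n]`.
  lift-gallaiSchur : ∀ k {n N r r′ q} (E : Colouring) → N < suc n * p → GallaiSchur k n r q →
    (∀ u → E (u * p) ≡ q u) → IsPartition N r′ E →
    (∀ a b → InRange N a → InRange N b → InRange N (a + b) →
      (∃₂ λ u v → u * p ≡ a × v * p ≡ b) ⊎ TwoColoured (E a) (E b) (E (a + b))) →
    GallaiSchur k N r′ E
  lift-gallaiSchur k {n} {N} {q = q} E N< (_ , sumFree , rainbowFree) E-mult part split =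
    part , sumFree-intro k sf , rf
    where
    E-sum : ∀ u v → E (u * p + v * p) ≡ q (u + v)
    E-sum u v = trans (cong E (sym (*-distribʳ-+ p u v))) (E-mult (u + v))

    down : ∀ {u} → InRange N (u * p) → InRange n u
    down {u} = inRange-*⁻¹ u N<

    sum-down : ∀ u v → InRange N (u * p + v * p) → InRange n (u + v)
    sum-down u v rs = down (subst (InRange N) (sym (*-distribʳ-+ p u v)) rs)

    sf : ∀ a b → InRange N a → InRange N b → InRange N (a + b) → Eligible k a b →
         ¬ (E a ≡ E b × E b ≡ E (a + b))
    sf a b ra rb rs el (eq₁ , eq₂) with split a b ra rb rs
    ... | inj₂ two = twoColoured⇒¬mono two (eq₁ , eq₂)
    ... | inj₁ (u , v , refl , refl) =
      sumFree-elim k sumFree u v (down ra) (down rb) (sum-down u v rs)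
        (eligible-map k (cong (_* p)) el)
        ( trans (sym (E-mult u)) (trans eq₁ (E-mult v))
        , trans (sym (E-mult v)) (trans eq₂ (E-sum u v)))

    rf : RainbowFree N E
    rf a b ra rb rs (ne₁ , ne₂ , ne₃) with split a b ra rb rs
    ... | inj₂ two = twoColoured⇒¬rainbow two (ne₁ , ne₂ , ne₃)
    ... | inj₁ (u , v , refl , refl) =
      rainbowFree u v (down ra) (down rb) (sum-down u v rs)
        ( (λ eq → ne₁ (trans (E-mult u) (trans eq (sym (E-mult v)))))
        , (λ eq → ne₂ (trans (E-mult v) (trans eq (sym (E-sum u v)))))
        , (λ eq → ne₃ (trans (E-mult u) (trans eq (sym (E-sum u v))))))

-- Consequences of maximality and arithmetic of residues

maximal⇒residue : ∀ p {k m r c E} → Maximal k m r c →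
  GallaiSchur k (p + m / suc p * suc p) r E → m % suc p ≡ p
maximal⇒residue p {m = m} {E = E} (_ , max) gs with m % suc p ≟ p
... | yes eq = eq
... | no neq = contradiction gs (max _ m<N E)
  where
  -- `N` is the largest number with the same quotient by `suc p` as `m`; a smaller residue would
  -- leave room for the longer partition `E`.
  m<N : m < p + m / suc p * suc p
  m<N = ≤-<-trans (≤-reflexive (m≡m%n+[m/n]*n m (suc p)))
    (+-monoˡ-< (m / suc p * suc p) (≤∧≢⇒< (≤-pred (m%n<n m (suc p))) neq))

residue⇒quotient : ∀ p m → m % suc p ≡ p → (m ∸ p) / suc p ≡ m / suc p
residue⇒quotient p m eq = trans (cong (_/ suc p) m∸p) (m*n/n≡m (m / suc p) (suc p))
  where
  m∸p : m ∸ p ≡ m / suc p * suc p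
  m∸p = trans (cong (_∸ p) (trans (m≡m%n+[m/n]*n m (suc p)) (cong (_+ m / suc p * suc p) eq)))
              (m+n∸m≡n p _)

+-*-interchange : ∀ i u j v p → (i + u * p) + (j + v * p) ≡ (i + j) + (u + v) * p
+-*-interchange = solve-∀

samePartition-via : ∀ m r (f : ℕ → ℕ) {c d} → (∀ i j → i < r → j < r → f i ≡ f j → i ≡ j) →
  (∀ x → InRange m x → c x < r) → (∀ x → InRange m x → d x ≡ f (c x)) → SamePartition m c d
samePartition-via m r f inj bounded d≡f x y rx ry = mk⇔
  (λ eq → trans (d≡f x rx) (trans (cong f eq) (sym (d≡f y ry))))
  (λ eq → inj _ _ (bounded x rx) (bounded y ry) (trans (sym (d≡f x rx)) (trans eq (d≡f y ry))))

-- The maps `Θ2` and `Θ5` preserve the Gallai-Schur property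

module _ (r : ℕ) (q : Colouring) where

  Θ2-%≡0 : ∀ x → x % 2 ≡ 0 → Θ2 r q x ≡ q (x / 2)
  Θ2-%≡0 x eq with x % 2 | eq
  ... | .0 | refl = refl

  Θ2-%≡1 : ∀ x → x % 2 ≡ 1 → Θ2 r q x ≡ r
  Θ2-%≡1 x eq with x % 2 | eq
  ... | .1 | refl = refl

  Θ2-0 : ∀ u → Θ2 r q (u * 2) ≡ q u
  Θ2-0 u = trans (Θ2-%≡0 (u * 2) (m*n%n≡0 u 2)) (cong q (m*n/n≡m u 2))

  Θ2-1 : ∀ u → Θ2 r q (1 + u * 2) ≡ r
  Θ2-1 u = Θ2-%≡1 (1 + u * 2) ([m+kn]%n≡m%n 1 u 2)

  Θ5-%≡0 : ∀ x → x % 5 ≡ 0 → Θ5 r q x ≡ q (x / 5)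
  Θ5-%≡0 x eq with x % 5 | eq
  ... | .0 | refl = refl

  Θ5-0 : ∀ u → Θ5 r q (u * 5) ≡ q u
  Θ5-0 u = trans (Θ5-%≡0 (u * 5) (m*n%n≡0 u 5)) (cong q (m*n/n≡m u 5))

  Θ5-1 : ∀ u → Θ5 r q (1 + u * 5) ≡ suc r
  Θ5-1 u with (1 + u * 5) % 5 | [m+kn]%n≡m%n 1 u 5
  ... | .1 | refl = refl

  Θ5-2 : ∀ u → Θ5 r q (2 + u * 5) ≡ r
  Θ5-2 u with (2 + u * 5) % 5 | [m+kn]%n≡m%n 2 u 5
  ... | .2 | refl = refl

  Θ5-3 : ∀ u → Θ5 r q (3 + u * 5) ≡ r
  Θ5-3 u with (3 + u * 5) % 5 | [m+kn]%n≡m%n 3 u 5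
  ... | .3 | refl = refl

  Θ5-4 : ∀ u → Θ5 r q (4 + u * 5) ≡ suc r
  Θ5-4 u with (4 + u * 5) % 5 | [m+kn]%n≡m%n 4 u 5
  ... | .4 | refl = refl

-- Hue 0 stands for many colours, so agreement of hues gives agreement of colours only away from 0;
-- hence the agreeing pair must be nonzero.
TwoHued : ℕ → ℕ → ℕ → Set
TwoHued g h l = (g ≡ h × g ≢ 0 × g ≢ l) ⊎ (g ≡ l × g ≢ 0 × g ≢ h) ⊎ (h ≡ l × h ≢ 0 × h ≢ g)

twoHued? : ∀ g h l → Dec (TwoHued g h l)
twoHued? g h l =
  ((g ≟ h) ×-dec ¬? (g ≟ 0) ×-dec ¬? (g ≟ l)) ⊎-dec
  ((g ≟ l) ×-dec ¬? (g ≟ 0) ×-dec ¬? (g ≟ h)) ⊎-dec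
  ((h ≟ l) ×-dec ¬? (h ≟ 0) ×-dec ¬? (h ≟ g))

-- Hue 0 stands for the rescaled old colours, hue h + 1 for the new colour r + h.
paint : ℕ → ℕ → ℕ → ℕ
paint r zero    y = y
paint r (suc h) y = h + r

paint-≡ : ∀ r h {y y′} → h ≢ 0 → paint r h y ≡ paint r h y′
paint-≡ r zero    h≢0 = contradiction refl h≢0
paint-≡ r (suc h) _   = refl

paint-≢ : ∀ r h h′ {y y′} → h ≢ 0 → h ≢ h′ → (h′ ≡ 0 → y′ < r) → paint r h y ≢ paint r h′ y′
paint-≢ r zero    _        h≢0 _    _    = contradiction refl h≢0
paint-≢ r (suc h) zero     _   _    y′<r = <⇒≢ (<-≤-trans (y′<r refl) (m≤n+m r h)) ∘ sym
paint-≢ r (suc h) (suc h′) _   h≢h′ _    = h≢h′ ∘ cong suc ∘ +-cancelʳ-≡ r h h′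

paint-twoColoured : ∀ r g h l {x y z} → TwoHued g h l →
  (g ≡ 0 → x < r) → (h ≡ 0 → y < r) → (l ≡ 0 → z < r) →
  TwoColoured (paint r g x) (paint r h y) (paint r l z)
paint-twoColoured r g h l (inj₁ (refl , g≢0 , g≢l)) _ _ z<r =
  xxy (paint-≡ r g g≢0) (paint-≢ r g l g≢0 g≢l z<r)
paint-twoColoured r g h l (inj₂ (inj₁ (refl , g≢0 , g≢h))) _ y<r _ =
  xyx (paint-≡ r g g≢0) (paint-≢ r g h g≢0 g≢h y<r)
paint-twoColoured r g h l (inj₂ (inj₂ (refl , h≢0 , h≢g))) x<r _ _ =
  yxx (paint-≡ r h h≢0) (paint-≢ r h g h≢0 h≢g x<r ∘ sym)

module Image (p′ t : ℕ) (hue : Fin (suc p′) → ℕ)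
  (hue≤t : ∀ i → hue i ≤ t)
  (hue-onto : ∀ h → h < t → ∃ λ i → hue i ≡ suc h)
  (hue≡0⇒zero : ∀ i → hue i ≡ 0 → i ≡ zero)
  (hue-zero : hue zero ≡ 0)
  (table : ∀ i j → (i ≡ zero × j ≡ zero) ⊎ TwoHued (hue i) (hue j) (hue ((toℕ i + toℕ j) mod suc p′)))
  where

  p : ℕ
  p = suc p′

  -- Only residues matter: two zero residues give a sum of the old partition, and for any other pair
  -- `table` provides two equal new colours and a different third one.
  image-gallaiSchur : ∀ k n r q (E : Colouring) → (∀ i u → E (toℕ i + u * p) ≡ paint r (hue i) (q u)) →
    GallaiSchur k n r q → GallaiSchur k (p′ + n * p) (t + r) E
  image-gallaiSchur k n r q E E≡ gs@((bounded , onto) , _) =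
    lift-gallaiSchur p k E ≤-refl gs E-mult (bounded′ , onto′)
      (λ a b → split (a divMod p) (b divMod p))
    where
    N : ℕ
    N = p′ + n * p

    E-mult : ∀ u → E (u * p) ≡ q u
    E-mult u = trans (E≡ zero u) (cong (λ h → paint r h (q u)) hue-zero)

    old<r : ∀ i u → InRange N (toℕ i + u * p) → hue i ≡ 0 → q u < r
    old<r i u ru eq with hue≡0⇒zero i eq
    ... | refl = bounded u (inRange-*⁻¹ p u ≤-refl ru)

    bounded′ : ∀ x → InRange N x → E x < t + r
    bounded′ x rx with x divMod p
    ... | result u i refl = subst (_< t + r) (sym (E≡ i u)) (paint< (hue i) (hue≤t i) (old<r i u rx))
      where
      paint< : ∀ h → h ≤ t → (h ≡ 0 → q u < r) → paint r h (q u) < t + r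
      paint< zero    _   qu<r = <-≤-trans (qu<r refl) (m≤n+m r t)
      paint< (suc h) h<t _    = +-monoˡ-< r h<t

    onto′ : ∀ i → i < t + r → ∃ λ x → InRange N x × E x ≡ i
    onto′ i i<t+r with i <? r
    ... | yes i<r with onto i i<r
    ...   | u , ru , eq = u * p , inRange-* p (m≤n+m (n * p) p′) ru , trans (E-mult u) eq
    onto′ i i<t+r | no i≮r with hue-onto (i ∸ r) (subst (i ∸ r <_) (m+n∸n≡m t r) (∸-monoˡ-< i<t+r (≮⇒≥ i≮r)))
    -- A new colour is attained at the residue itself, which is positive because its hue is nonzero.
    -- The value `q 0`, outside the interval, is discarded by `paint`.
    ... | j , eq = toℕ j + 0 , (subst (1 ≤_) (sym (+-identityʳ _)) (j≥1 j eq) , j≤N) ,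
                   trans (E≡ j 0) (trans (cong (λ h → paint r h (q 0)) eq) (m∸n+n≡m (≮⇒≥ i≮r)))
      where
      j≥1 : ∀ j {h} → hue j ≡ suc h → 1 ≤ toℕ j
      j≥1 zero    eq = contradiction (trans (sym hue-zero) eq) (λ ())
      j≥1 (suc j) _  = s≤s z≤n
      j≤N : toℕ j + 0 ≤ N
      j≤N = +-mono-≤ (toℕ≤pred[n] j) z≤n

    split : ∀ {a b} → DivMod a p → DivMod b p → InRange N a → InRange N b → InRange N (a + b) →
      (∃₂ λ u v → u * p ≡ a × v * p ≡ b) ⊎ TwoColoured (E a) (E b) (E (a + b))
    split (result u i refl) (result v j refl) ra rb rs with table i j
    ... | inj₁ (refl , refl) = inj₁ (u , v , refl , refl)
    ... | inj₂ two = inj₂ (subst₂ (λ x y → TwoColoured x y (E s)) (sym (E≡ i u)) (sym (E≡ j v))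
            (subst (TwoColoured _ _) (sym (trans (cong E s≡) (E≡ l w)))
              (paint-twoColoured r (hue i) (hue j) (hue l) two
                (old<r i u ra) (old<r j v rb) (old<r l w (subst (InRange N) s≡ rs)))))
      where
      s w : ℕ
      s = (toℕ i + u * p) + (toℕ j + v * p)
      -- The carry from adding the residues goes into the quotient.
      w = (toℕ i + toℕ j) / p + (u + v)
      l : Fin p
      l = (toℕ i + toℕ j) mod p
      s≡ : s ≡ toℕ l + w * p
      s≡ = begin
        s                                                           ≡⟨ +-*-interchange (toℕ i) u (toℕ j) v p ⟩
        (toℕ i + toℕ j) + (u + v) * p                               ≡⟨ cong (_+ (u + v) * p) (DivMod.property ((toℕ i + toℕ j) divMod p)) ⟩
        (toℕ l + (toℕ i + toℕ j) / p * p) + (u + v) * p             ≡⟨ +-assoc (toℕ l) _ _ ⟩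
        toℕ l + ((toℕ i + toℕ j) / p * p + (u + v) * p)             ≡⟨ cong (toℕ l +_) (sym (*-distribʳ-+ p ((toℕ i + toℕ j) / p) (u + v))) ⟩
        toℕ l + w * p                                               ∎
        where open ≡-Reasoning

hue2 : Fin 2 → ℕ
hue2 0F = 0
hue2 1F = 1

-- The nonzero squares 1, 4 and the non-squares 2, 3 modulo 5; each class is sum-free.
hue5 : Fin 5 → ℕ
hue5 0F = 0
hue5 1F = 2
hue5 2F = 1
hue5 3F = 1
hue5 4F = 2

Θ2≡paint : ∀ r q i u → Θ2 r q (toℕ i + u * 2) ≡ paint r (hue2 i) (q u)
Θ2≡paint r q 0F = Θ2-0 r q
Θ2≡paint r q 1F = Θ2-1 r q

Θ5≡paint : ∀ r q i u → Θ5 r q (toℕ i + u * 5) ≡ paint r (hue5 i) (q u)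
Θ5≡paint r q 0F = Θ5-0 r q
Θ5≡paint r q 1F = Θ5-1 r q
Θ5≡paint r q 2F = Θ5-2 r q
Θ5≡paint r q 3F = Θ5-3 r q
Θ5≡paint r q 4F = Θ5-4 r q

Θ2-gallaiSchur : ∀ k n r q → GallaiSchur k n r q → GallaiSchur k (1 + n * 2) (1 + r) (Θ2 r q)
Θ2-gallaiSchur k n r q = Image.image-gallaiSchur 1 1 hue2
  (from-yes (all? λ i → hue2 i ≤? 1))
  (λ { zero _ → 1F , refl ; (suc _) (s≤s ()) })
  (λ { 0F _ → refl ; 1F () }) refl
  (from-yes (all? λ i → all? λ j → (i Fin.≟ zero ×-dec j Fin.≟ zero) ⊎-dec
    twoHued? (hue2 i) (hue2 j) (hue2 ((toℕ i + toℕ j) mod 2))))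
  k n r q (Θ2 r q) (Θ2≡paint r q)

Θ5-gallaiSchur : ∀ k n r q → GallaiSchur k n r q → GallaiSchur k (4 + n * 5) (2 + r) (Θ5 r q)
Θ5-gallaiSchur k n r q = Image.image-gallaiSchur 4 2 hue5
  (from-yes (all? λ i → hue5 i ≤? 2))
  (λ { 0 _ → 2F , refl ; 1 _ → 1F , refl ; (suc (suc _)) (s≤s (s≤s ())) })
  (λ { 0F _ → refl ; 1F () ; 2F () ; 3F () ; 4F () }) refl
  -- A finite check over pairs of residues, settled by evaluation.
  (from-yes (all? λ i → all? λ j → (i Fin.≟ zero ×-dec j Fin.≟ zero) ⊎-dec
    twoHued? (hue5 i) (hue5 j) (hue5 ((toℕ i + toℕ j) mod 5))))
  k n r q (Θ5 r q) (Θ5≡paint r q)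

-- Maximal partitions as images

recolour2 : ℕ → ℕ → ℕ
recolour2 r zero    = r
recolour2 r (suc j) = j

recolour2-injective : ∀ r i j → i < 1 + r → j < 1 + r → recolour2 r i ≡ recolour2 r j → i ≡ j
recolour2-injective r zero    zero    _         _         _  = refl
recolour2-injective r zero    (suc j) _         (s≤s j<r) eq = contradiction (sym eq) (<⇒≢ j<r)
recolour2-injective r (suc i) zero    (s≤s i<r) _         eq = contradiction eq (<⇒≢ i<r)
recolour2-injective r (suc i) (suc j) _         _         eq = cong suc eq

-- Natural order labels the classes of 1 and 2 by 0 and 1, while `Θ5` labels them `suc r` and `r`;
-- the other labels drop by 2.
recolour5 : ℕ → ℕ → ℕ
recolour5 r zero    = suc r
recolour5 r (suc i) = recolour2 r i

recolour2≤r : ∀ r j → j < 1 + r → recolour2 r j ≤ r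
recolour2≤r r zero    _         = ≤-refl
recolour2≤r r (suc j) (s≤s j<r) = <⇒≤ j<r

recolour5-injective : ∀ r i j → i < 2 + r → j < 2 + r → recolour5 r i ≡ recolour5 r j → i ≡ j
recolour5-injective r zero    zero    _        _        _  = refl
recolour5-injective r zero    (suc j) _        (s≤s j<) eq = contradiction (sym eq) (<⇒≢ (s≤s (recolour2≤r r j j<)))
recolour5-injective r (suc i) zero    (s≤s i<) _        eq = contradiction eq (<⇒≢ (s≤s (recolour2≤r r i i<)))
recolour5-injective r (suc i) (suc j) (s≤s i<) (s≤s j<) eq = cong suc (recolour2-injective r i j i< j< eq)

module _ (k : Kind) (m r : ℕ) (c : Colouring) where

  -- The even numbers carry a partition `q` of `[1, m / 2]`. Its image is Gallai-Schur up to
  -- `1 + m / 2 * 2`, which is at least `m`, so maximality forces equality and `m` is odd.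
  maximal⇒Θ2-image : Maximal k m (1 + r) c →
    (∀ u → 1 + u * 2 ≤ m → c (1 + u * 2) ≡ 0) → (∀ u → InRange m (u * 2) → 1 ≤ c (u * 2)) →
    m % 2 ≡ 1 × ∃ λ q → GallaiSchur k ((m ∸ 1) / 2) r q × SamePartition m c (Θ2 r q)
  maximal⇒Θ2-image max@(gs , _) odd≡0 even≥1 =
    m%2≡1 , q , subst (λ n → GallaiSchur k n r q) (sym (residue⇒quotient 1 m m%2≡1)) gs-q ,
    samePartition-via m (1 + r) (recolour2 r) (recolour2-injective r) (proj₁ (proj₁ gs)) Θ≡
    where
    q : Colouring
    q u = c (u * 2) ∸ 1

    ≥1⇒multiple : ∀ x → InRange m x → 1 ≤ c x → ∃ λ u → x ≡ u * 2
    ≥1⇒multiple x rx 1≤cx with x divMod 2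
    ... | result u 0F eq   = u , eq
    ... | result u 1F refl = contradiction (odd≡0 u (proj₂ rx)) (m<n⇒n≢0 1≤cx)

    gs-q : GallaiSchur k (m / 2) r q
    gs-q = restrict-gallaiSchur 2 1 k gs even≥1 ≥1⇒multiple

    m%2≡1 : m % 2 ≡ 1
    m%2≡1 = maximal⇒residue 1 max (Θ2-gallaiSchur k (m / 2) r q gs-q)

    recolour2-≥1 : ∀ {j} → 1 ≤ j → j ∸ 1 ≡ recolour2 r j
    recolour2-≥1 (s≤s _) = refl

    Θ≡ : ∀ x → InRange m x → Θ2 r q x ≡ recolour2 r (c x)
    Θ≡ x rx with x divMod 2
    ... | result u 0F refl = trans (Θ2-0 r q u) (recolour2-≥1 (even≥1 u rx))
    ... | result u 1F refl = trans (Θ2-1 r q u) (cong (recolour2 r) (sym (odd≡0 u (proj₂ rx))))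

  maximal⇒Θ5-image : (max : Maximal k m (2 + r) c) →
    (∀ u → Forcing.Row5 k m (2 + r) c (proj₁ max) u) → (∀ u → InRange m (u * 5) → 2 ≤ c (u * 5)) →
    m % 5 ≡ 4 × ∃ λ q → GallaiSchur k ((m ∸ 4) / 5) r q × SamePartition m c (Θ5 r q)
  maximal⇒Θ5-image max@(gs , _) row mult≥2 =
    m%5≡4 , q , subst (λ n → GallaiSchur k n r q) (sym (residue⇒quotient 4 m m%5≡4)) gs-q ,
    samePartition-via m (2 + r) (recolour5 r) (recolour5-injective r) (proj₁ (proj₁ gs)) Θ≡
    where
    open Forcing.Row5
    q : Colouring
    q u = c (u * 5) ∸ 2

    ≥2⇒multiple : ∀ x → InRange m x → 2 ≤ c x → ∃ λ u → x ≡ u * 5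
    ≥2⇒multiple x (_ , x≤m) 2≤cx with x divMod 5
    ... | result u 0F eq   = u , eq
    ... | result u 1F refl = contradiction (at1 (row u) x≤m) (m<n⇒n≢0 2≤cx)
    ... | result u 2F refl = contradiction (sym (at2 (row u) x≤m)) (<⇒≢ 2≤cx)
    ... | result u 3F refl = contradiction (sym (at3 (row u) x≤m)) (<⇒≢ 2≤cx)
    ... | result u 4F refl = contradiction (at4 (row u) x≤m) (m<n⇒n≢0 2≤cx)

    gs-q : GallaiSchur k (m / 5) r q
    gs-q = restrict-gallaiSchur 5 2 k gs mult≥2 ≥2⇒multiple

    m%5≡4 : m % 5 ≡ 4
    m%5≡4 = maximal⇒residue 4 max (Θ5-gallaiSchur k (m / 5) r q gs-q)

    recolour5-≥2 : ∀ {j} → 2 ≤ j → j ∸ 2 ≡ recolour5 r j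
    recolour5-≥2 (s≤s (s≤s _)) = refl

    Θ≡ : ∀ x → InRange m x → Θ5 r q x ≡ recolour5 r (c x)
    Θ≡ x rx@(_ , x≤m) with x divMod 5
    ... | result u 0F refl = trans (Θ5-0 r q u) (recolour5-≥2 (mult≥2 u rx))
    ... | result u 1F refl = trans (Θ5-1 r q u) (cong (recolour5 r) (sym (at1 (row u) x≤m)))
    ... | result u 2F refl = trans (Θ5-2 r q u) (cong (recolour5 r) (sym (at2 (row u) x≤m)))
    ... | result u 3F refl = trans (Θ5-3 r q u) (cong (recolour5 r) (sym (at3 (row u) x≤m)))
    ... | result u 4F refl = trans (Θ5-4 r q u) (cong (recolour5 r) (sym (at4 (row u) x≤m)))

-- Conclusion from the four initial words

theorem2 : (k : Kind) (r m : ℕ) (c : Colouring) → 3 < r →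
    Maximal k m r c → NaturalOrder m r c →
    (c 1 ≡ 0 × c 2 ≡ 1 × c 3 ≡ 1 × m % 5 ≡ 4 ×
    ∃ λ q → GallaiSchur k ((m ∸ 4) / 5) (r ∸ 2) q × SamePartition m c (Θ5 (r ∸ 2) q))
    ⊎
    (c 1 ≡ 0 × c 2 ≡ 1 × c 3 ≡ 0 × m % 2 ≡ 1 ×
    ∃ λ q → GallaiSchur k ((m ∸ 1) / 2) (r ∸ 1) q × SamePartition m c (Θ2 (r ∸ 1) q))
theorem2 k (suc zero) m c (s≤s ())
theorem2 k (suc (suc r)) m c 3<r max@(gs , _) nat = conclude classification
  where
  open Forcing k m (suc (suc r)) c gs
  open Initial (<⇒≤ 3<r) nat

  module _ (c1 : c 1 ≡ 0) (c2 : c 2 ≡ 1) where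

    second-case : (∀ u → 1 + u * 2 ≤ m → c (1 + u * 2) ≡ 0) →
      m % 2 ≡ 1 × ∃ λ q → GallaiSchur k ((m ∸ 1) / 2) (suc r) q × SamePartition m c (Θ2 (suc r) q)
    second-case odd = maximal⇒Θ2-image k m (suc r) c max odd
      λ { zero (() , _) ; (suc u) (_ , le) → even≥1 c1 c2 odd u le }

    first-case : c 3 ≡ 1 → c 4 ≡ 0 →
      m % 5 ≡ 4 × ∃ λ q → GallaiSchur k ((m ∸ 4) / 5) r q × SamePartition m c (Θ5 r q)
    first-case c3 c4 = maximal⇒Θ5-image k m r c max row
      λ { zero (() , _) ; (suc u) (_ , le) → multiple≥2 u (row u) le }
      where open Fives c1 c2 c3 c4

  conclude : c 1 ≡ 0 × c 2 ≡ 1 × Start → _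
  conclude (c1 , c2 , ABAC c3 c4) =
    inj₂ (c1 , c2 , c3 , second-case c1 c2 (ABAC⇒odd≡0 c1 c2 c3 c4))
  conclude (c1 , c2 , ABABAC c3 c5 c6) =
    inj₂ (c1 , c2 , c3 , second-case c1 c2 (ABABAC⇒odd≡0 c1 c2 c3 c5 c6))
  conclude (c1 , c2 , ABBAC c3 c4) =
    inj₁ (c1 , c2 , c3 , first-case c1 c2 c3 c4)
  -- The hypothesis `3<r` supplies an element of the fourth colour, which this word cannot
  -- accommodate.
  conclude (c1 , c2 , ABBBAC c3 c4 c5 c6) with proj₂ (proj₁ gs) 3 3<r
  ... | w , rw , cw = contradiction cw (ABBBAC⇒no-fourth-colour c1 c2 c3 c4 c5 c6 w rw)
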